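{- Consider FULLSET MALIQUOT. Then $\mathcal{SG}(n)\in\{0,1\}$, and $\mathcal{SG}(n)=1$ if and only if $n>1$ is square-free.
   Context: FULLSET MALIQUOT is the impartial normal-play game on positive integers where the single option from a heap $n>1$ is the disjunctive sum of all proper divisors of $n$ (all $d\mid n$ with $1\le d<n$); a heap of size $1$ is terminal. $\mathcal{SG}$ denotes the Sprague-Grundy value (mex rule, nim-sum). -}

module Defs where

open import Data.Fin.Base using (Fin; toℕ; fromℕ; fromℕ<; inject)
open import Data.Fin.Properties using (toℕ<n; toℕ-fromℕ; toℕ-fromℕ<; toℕ-inject; ¬∀⟶∃¬-smallest)
open import Data.List.Base using (List; map; filter; foldr; allFin; tabulate)
open import Data.List.Extrema.Nat using (max; xs≤max)
open import Data.List.Membership.DecPropositional using () renaming (_∈?_ to mem?)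
open import Data.List.Membership.Propositional using (_∈_; _∉_)
open import Data.List.Properties using (map-cong)
open import Data.List.Relation.Unary.All using (lookup)
open import Data.Nat.Base using (ℕ; suc; _*_; _≤_; _<_)
open import Data.Nat.Divisibility using (_∣_; _∣?_)
open import Data.Nat.Induction using (<-wellFounded; <-rec)
open import Data.Nat.Properties using (_≟_; _≤?_; _<?_; 1+n≰n)
open import Data.Product.Base using (∃; _×_; proj₁; proj₂)
open import Data.Vec.Functional using (Vector; _++_)
open import Function.Base using (const)
open import Induction.WellFounded using (module FixPoint)
open import Relation.Binary.PropositionalEquality using (_≡_; refl; trans; cong; subst)
open import Relation.Nullary.Decidable using (Dec; yes; no; _×-dec_)
open import Relation.Nullary.Negation using (¬_)

mexWitness : (xs : List ℕ) → ∃ λ (i : Fin (suc (suc (max 0 xs)))) →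
             toℕ i ∉ xs × (∀ j → toℕ (inject {i = i} j) ∈ xs)
mexWitness xs = ¬∀⟶∃¬-smallest _ (λ i → toℕ i ∈ xs) (λ i → mem? _≟_ (toℕ i) xs) notAll
  where
  notAll : ¬ (∀ i → toℕ i ∈ xs)
  notAll all = 1+n≰n (lookup (xs≤max 0 xs)
                 (subst (_∈ xs) (toℕ-fromℕ (suc (max 0 xs))) (all (fromℕ _))))

mex : List ℕ → ℕ
mex xs = toℕ (proj₁ (mexWitness xs))

mex∉ : ∀ xs → mex xs ∉ xs
mex∉ xs = proj₁ (proj₂ (mexWitness xs))

<mex⇒∈ : ∀ xs {m} → m < mex xs → m ∈ xs
<mex⇒∈ xs m<mex =
  subst (_∈ xs) (trans (toℕ-inject {i = proj₁ (mexWitness xs)} (fromℕ< m<mex)) (toℕ-fromℕ< m<mex))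
    (proj₂ (proj₂ (mexWitness xs)) (fromℕ< m<mex))

-- A position of a finite, loop-free impartial game, given by its options.
data Game : Set where
  node : ∀ {k} → Vector Game k → Game

𝟘 : Game
𝟘 = node {0} λ ()

-- Disjunctive sum: a move is a move in exactly one of the components.
infixr 6 _⊕_
_⊕_ : Game → Game → Game
G@(node f) ⊕ H@(node g) = node ((λ i → f i ⊕ H) ++ (λ j → G ⊕ g j))

⨁ : List Game → Game
⨁ = foldr _⊕_ 𝟘

-- The value of a disjunctive sum is also defined by the mex rule, through its
-- game tree; that it equals the nim-sum of the values is not built in.
SG : Game → ℕ
SG (node f) = mex (tabulate λ i → SG (f i))

IsProperDivisor : ℕ → ℕ → Set
IsProperDivisor n d = 1 ≤ d × d < n × d ∣ n

isProperDivisor? : ∀ n d → Dec (IsProperDivisor n d)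
isProperDivisor? n d = 1 ≤? d ×-dec d <? n ×-dec d ∣? n

properDivisors : ∀ n → List (Fin n)
properDivisors n = filter (λ d → isProperDivisor? n (toℕ d)) (allFin n)

heapStep : ∀ n → (∀ {d} → d < n → Game) → Game
heapStep n smaller with 1 <? n
... | yes _ = node {1} (const (⨁ (map (λ d → smaller (toℕ<n d)) (properDivisors n))))
... | no  _ = 𝟘

-- A heap of FULLSET MALIQUOT. The value heap 0 ≡ 𝟘 is junk: heaps are positive.
heap : ℕ → Game
heap = <-rec (const Game) heapStep

heapStep-ext : ∀ n {s t : ∀ {d} → d < n → Game} →
               (∀ {d} (d<n : d < n) → s d<n ≡ t d<n) → heapStep n s ≡ heapStep n t
heapStep-ext n s≗t with 1 <? n
... | yes _ = cong (λ gs → node {1} (const (⨁ gs)))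
                (map-cong (λ d → s≗t (toℕ<n d)) (properDivisors n))
... | no  _ = refl

heap-unfold : ∀ n → heap n ≡ heapStep n (λ {d} _ → heap d)
heap-unfold n = FixPoint.unfold-wfRec <-wellFounded (const Game) heapStep heapStep-ext {n}

SquareFree : ℕ → Set
SquareFree n = ∀ d → d * d ∣ n → d ≡ 1

{-# OPTIONS --safe #-}
-- Every move in a sum of heaps flips the Grundy value between 0 and 1, so a sum
-- has the parity of its number of heaps of value 1 and no general nim-sum is needed.
-- The theorem then says that a number n > 1 has an even number of square-free
-- divisors. For a prime p dividing n, d ↦ p * d is a bijection from the square-free
-- divisors of n prime to p onto those divisible by p, so they come in pairs.
module Submission where

open import Defs
open import Data.Fin.Base as Fin using (Fin; toℕ; fromℕ<; _↑ˡ_; _↑ʳ_)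
open import Data.Fin.Properties using (toℕ-injective; toℕ-fromℕ<; toℕ<n)
open import Data.List.Base using (List; []; _∷_; _++_; map; filter; tabulate; length; upTo; allFin)
open import Data.List.Membership.Propositional using (_∈_; _∉_)
open import Data.List.Membership.Propositional.Properties
open import Data.List.Membership.Propositional.Properties.WithK using (unique∧set⇒bag)
open import Data.List.Properties using (length-++; length-map)
open import Data.List.Relation.Binary.BagAndSetEquality using (∼bag⇒↭)
open import Data.List.Relation.Binary.Permutation.Propositional.Properties using (↭-length)
open import Data.List.Relation.Unary.All as All using (All; []; _∷_)
open import Data.List.Relation.Unary.AllPairs using (_∷_)
open import Data.List.Relation.Unary.Any using (here; there)
open import Data.List.Relation.Unary.Unique.Propositional using (Unique)
import Data.List.Relation.Unary.Unique.Propositional.Properties as Unique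
open import Data.Nat.Base using (ℕ; suc; _+_; _*_; _<_; NonZero; nonTrivial⇒≢1; z<s; s≤s; z≤n; parity; >-nonZero; >-nonZero⁻¹; ≢-nonZero; ≢-nonZero⁻¹)
open import Data.Nat.Coprimality using (Coprime; coprime-divisor)
open import Data.Nat.Divisibility
open import Data.Nat.Induction using (<-rec)
open import Data.Nat.ListAction using (product)
open import Data.Nat.Primality using (Prime; prime⇒irreducible; prime⇒nonZero; prime⇒nonTrivial; euclidsLemma)
open import Data.Nat.Primality.Factorisation using (factorise)
open import Data.Nat.Properties
open import Data.Parity.Base as ℙ using (Parity; 0ℙ; 1ℙ; _⁻¹)
import Data.Parity.Properties as ℙ
open import Data.Product.Base using (∃; _×_; _,_; proj₁; proj₂)
open import Data.Sum.Base using (_⊎_; inj₁; inj₂; [_,_]′)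
open import Data.Vec.Functional using (Vector)
open import Data.Vec.Functional.Relation.Unary.All.Properties using (++⁺)
open import Function.Base using (case_of_)
open import Function.Bundles using (_⇔_; mk⇔)
open import Relation.Binary.Definitions using (tri<; tri≈; tri>)
open import Relation.Binary.PropositionalEquality using (_≡_; _≢_; refl; sym; ≢-sym; trans; cong; subst)
open import Relation.Nullary.Decidable using (Dec; yes; no; map′; _×-dec_; _→-dec_; ¬?)
open import Relation.Nullary.Negation using (¬_; contradiction)
open import Relation.Unary using (Pred; Decidable)

-- Games in which every move flips the Grundy value between 0 and 1

-- The parity is the intended Grundy value. Value 1 requires an option of value 0, hence the
-- function from `p ≡ 1ℙ`; a position of value 0 may be terminal.
data Alternating : Parity → Game → Set where
  alternating : ∀ {p k} {f : Vector Game k} → (p ≡ 1ℙ → Fin k) →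
                (∀ i → Alternating (p ⁻¹) (f i)) → Alternating p (node f)

value : Parity → ℕ
value 0ℙ = 0
value 1ℙ = 1

mex-unique : ∀ xs {m} → m ∉ xs → (∀ {j} → j < m → j ∈ xs) → mex xs ≡ m
mex-unique xs {m} m∉ below with <-cmp (mex xs) m
... | tri< mex<m _ _ = contradiction (below mex<m) (mex∉ xs)
... | tri≈ _ mex≡m _ = mex≡m
... | tri> _ _ m<mex = contradiction (<mex⇒∈ xs m<mex) m∉

-- All options share one value: if it is 1, or there are none, the mex is 0; if it is 0 and an
-- option exists, the mex is 1.
SG-alternating : ∀ {p G} → Alternating p G → SG G ≡ value p
SG-alternating {0ℙ} (alternating _ opts) = mex-unique _
  (λ 0∈ → let i , 0≡ = ∈-tabulate⁻ 0∈ in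
    case trans 0≡ (SG-alternating (opts i)) of λ ())
  λ ()
SG-alternating {1ℙ} {node f} (alternating move opts) = mex-unique _
  (λ 1∈ → let i , 1≡ = ∈-tabulate⁻ 1∈ in
    case trans 1≡ (SG-alternating (opts i)) of λ ())
  (λ { (s≤s z≤n) → subst (_∈ tabulate (λ i → SG (f i))) (SG-alternating (opts (move refl))) (∈-tabulate⁺ (move refl)) })

⁻¹-distribˡ-+ : ∀ p q → p ⁻¹ ℙ.+ q ≡ (p ℙ.+ q) ⁻¹
⁻¹-distribˡ-+ 0ℙ q = refl
⁻¹-distribˡ-+ 1ℙ q = sym (ℙ.⁻¹-involutive q)

⁻¹-distribʳ-+ : ∀ p q → p ℙ.+ q ⁻¹ ≡ (p ℙ.+ q) ⁻¹
⁻¹-distribʳ-+ 0ℙ q = refl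
⁻¹-distribʳ-+ 1ℙ q = refl

-- A move in one component flips that component's parity and hence the sum. If the sum is `1ℙ`, one
-- of the components has parity `1ℙ` and so offers a move.
⊕-alternating : ∀ {p q G H} → Alternating p G → Alternating q H → Alternating (p ℙ.+ q) (G ⊕ H)
⊕-alternating {p} {q} {node {k} f} {node {l} g} G@(alternating move-f opts-f) H@(alternating move-g opts-g) =
  alternating (move p q move-f move-g) (++⁺ (Alternating _)
    (λ i → subst (λ r → Alternating r (f i ⊕ node g)) (⁻¹-distribˡ-+ p q) (⊕-alternating (opts-f i) H))
    (λ j → subst (λ r → Alternating r (node f ⊕ g j)) (⁻¹-distribʳ-+ p q) (⊕-alternating G (opts-g j))))
  where
  move : ∀ p q → (p ≡ 1ℙ → Fin k) → (q ≡ 1ℙ → Fin l) → p ℙ.+ q ≡ 1ℙ → Fin (k + l)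
  move 0ℙ _ _ move-g q≡1 = k ↑ʳ move-g q≡1
  move 1ℙ _ move-f _ _   = move-f refl ↑ˡ l

𝟘-alternating : Alternating 0ℙ 𝟘
𝟘-alternating = alternating (λ ()) λ ()

parity-suc : ∀ n → parity (suc n) ≡ parity n ⁻¹
parity-suc n = trans (sym (ℙ.⁻¹-involutive _)) (cong _⁻¹ (ℙ.suc-homo-⁻¹ n))

parity[n+n]≡0ℙ : ∀ n → parity (n + n) ≡ 0ℙ
parity[n+n]≡0ℙ n = trans (ℙ.+-homo-+ n n) (ℙ.p+p≡0ℙ (parity n))

indicator : ∀ {P : Set} → Dec P → Parity
indicator (yes _) = 1ℙ
indicator (no _)  = 0ℙ

indicator-no : ∀ {P : Set} (P? : Dec P) → ¬ P → indicator P? ≡ 0ℙ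
indicator-no (yes p) ¬p = contradiction p ¬p
indicator-no (no _)  _  = refl

⨁-alternating : ∀ {A : Set} {P : Pred A _} (P? : Decidable P) (h : A → Game) →
                (∀ x → Alternating (indicator (P? x)) (h x)) →
                ∀ xs → Alternating (parity (length (filter P? xs))) (⨁ (map h xs))
⨁-alternating P? h alt []       = 𝟘-alternating
⨁-alternating P? h alt (x ∷ xs) with P? x | alt x
... | yes _ | alt-x = subst (λ r → Alternating r _) (sym (parity-suc (length (filter P? xs))))
                        (⊕-alternating alt-x (⨁-alternating P? h alt xs))
... | no _  | alt-x = ⊕-alternating alt-x (⨁-alternating P? h alt xs)

-- Square-free divisors

-- A search over d ≤ n suffices for positive n, since d divides d * d and hence n.
squareFree? : Decidable SquareFree
squareFree? n = map′ unbound (λ sf _ → sf _)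
  (allUpTo? (λ d → d * d ∣? n →-dec d ≟ 1) (suc n))
  where
  unbound : (∀ {d} → d < suc n → d * d ∣ n → d ≡ 1) → SquareFree n
  unbound bounded d d²∣n with n ≟ 0
  -- At n = 0 the bound on d breaks down, but the bounded search already fails at d = 0, because 0 *
  -- 0 divides 0.
  ... | yes refl = case bounded {0} z<s (divides 0 refl) of λ ()
  ... | no n≢0   = bounded (s≤s (∣⇒≤ {{≢-nonZero n≢0}} (∣-trans (m∣m*n d) d²∣n))) d²∣n

squareFree-∣ : ∀ {m n} → m ∣ n → SquareFree n → SquareFree m
squareFree-∣ m∣n sf d d²∣m = sf d (∣-trans d²∣m m∣n)

squareFree-1 : SquareFree 1
squareFree-1 d d²∣1 = ∣1⇒≡1 (∣-trans (m∣m*n d) d²∣1)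

prime∤⇒coprime : ∀ {p m} → Prime p → p ∤ m → Coprime m p
prime∤⇒coprime pr p∤m (d∣m , d∣p) with prime⇒irreducible pr d∣p
... | inj₁ d≡1  = d≡1
... | inj₂ refl = contradiction d∣m p∤m

-- Let d * d divide p * m. If p divides d, cancelling p from p * p ∣ p * m gives p ∣ m. Otherwise d
-- * d is coprime to p and divides m.
squareFree-* : ∀ {p m} → Prime p → p ∤ m → SquareFree m → SquareFree (p * m)
squareFree-* {p} {m} pr p∤m sf d d²∣pm with p ∣? d
... | yes p∣d = contradiction (*-cancelˡ-∣ p (∣-trans (*-pres-∣ p∣d p∣d) d²∣pm)) p∤m
  where instance _ = prime⇒nonZero pr
... | no p∤d  = sf d (coprime-divisor (prime∤⇒coprime pr p∤d²) d²∣pm)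
  where
  p∤d² : p ∤ d * d
  p∤d² p∣d² = [ p∤d , p∤d ]′ (euclidsLemma d d pr p∣d²)

squareFree-*⇒∤ : ∀ {p m} → Prime p → SquareFree (p * m) → p ∤ m
squareFree-*⇒∤ {p} pr sf p∣m = nonTrivial⇒≢1 {{prime⇒nonTrivial pr}} (sf p (*-monoʳ-∣ p p∣m))

-- Write n = q * p. As m is coprime to p, it divides q.
prime*∣ : ∀ {p m n} → Prime p → p ∤ m → p ∣ n → m ∣ n → p * m ∣ n
prime*∣ {p} {m} pr p∤m (divides q refl) m∣n =
  subst (p * m ∣_) (*-comm p q) (*-monoʳ-∣ p
    (coprime-divisor (prime∤⇒coprime pr p∤m) (subst (m ∣_) (*-comm q p) m∣n)))

∃-prime∣ : ∀ {n} → 1 < n → ∃ λ p → Prime p × p ∣ n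
∃-prime∣ {n} 1<n with factorise n {{>-nonZero (<-trans z<s 1<n)}}
... | record { factors = [] ; isFactorisation = refl } = contradiction 1<n (<-irrefl refl)
... | record { factors = p ∷ ps ; isFactorisation = refl ; factorsPrime = pr ∷ _ } =
  p , pr , m∣m*n (product ps)

-- For duplicate-free lists, equality as sets is equality as bags, hence a permutation. All counting
-- below compares members in this way.
unique∧⇔⇒length≡ : ∀ {A : Set} {xs ys : List A} → Unique xs → Unique ys →
                    (∀ {x} → x ∈ xs ⇔ x ∈ ys) → length xs ≡ length ys
unique∧⇔⇒length≡ xs! ys! eq = ↭-length (∼bag⇒↭ (unique∧set⇒bag xs! ys! eq))

squareFreeDivisor? : ∀ n → Decidable λ d → SquareFree d × d ∣ n
squareFreeDivisor? n d = squareFree? d ×-dec d ∣? n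

-- The range is 0, ..., n, with n included; 0 is filtered out because it is not square-free.
squareFreeDivisors : ℕ → List ℕ
squareFreeDivisors n = filter (squareFreeDivisor? n) (upTo (suc n))

squareFreeDivisors-unique : ∀ n → Unique (squareFreeDivisors n)
squareFreeDivisors-unique n = Unique.filter⁺ (squareFreeDivisor? n) (Unique.upTo⁺ (suc n))

∈-squareFreeDivisors⁺ : ∀ {n d} .{{_ : NonZero n}} → SquareFree d → d ∣ n → d ∈ squareFreeDivisors n
∈-squareFreeDivisors⁺ {n} sf d∣n =
  ∈-filter⁺ (squareFreeDivisor? n) (∈-upTo⁺ (s≤s (∣⇒≤ d∣n))) (sf , d∣n)

∈-squareFreeDivisors⁻ : ∀ {n d} → d ∈ squareFreeDivisors n → SquareFree d × d ∣ n
∈-squareFreeDivisors⁻ {n} d∈ = proj₂ (∈-filter⁻ (squareFreeDivisor? n) {xs = upTo (suc n)} d∈)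

-- Up to order, the list is `coprimes` followed by its image under `p *_`, so its length is twice
-- that of `coprimes`.
parity-squareFreeDivisors : ∀ {n} → 1 < n → parity (length (squareFreeDivisors n)) ≡ 0ℙ
parity-squareFreeDivisors {n} 1<n with p , pr , p∣n ← ∃-prime∣ 1<n =
  trans (cong parity length≡) (parity[n+n]≡0ℙ (length coprimes))
  where
  instance
    _ = >-nonZero (<-trans z<s 1<n)
    _ = prime⇒nonZero pr

  coprimes : List ℕ
  coprimes = filter (λ d → ¬? (p ∣? d)) (squareFreeDivisors n)

  ∈-coprimes⁻ : ∀ {d} → d ∈ coprimes → (SquareFree d × d ∣ n) × p ∤ d
  ∈-coprimes⁻ d∈ with d∈′ , p∤d ← ∈-filter⁻ (λ d → ¬? (p ∣? d)) {xs = squareFreeDivisors n} d∈ =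
    ∈-squareFreeDivisors⁻ d∈′ , p∤d

  ∈-coprimes⁺ : ∀ {d} → SquareFree d → d ∣ n → p ∤ d → d ∈ coprimes
  ∈-coprimes⁺ sf d∣n p∤d = ∈-filter⁺ (λ d → ¬? (p ∣? d)) (∈-squareFreeDivisors⁺ sf d∣n) p∤d

  coprimes-unique : Unique coprimes
  coprimes-unique = Unique.filter⁺ (λ d → ¬? (p ∣? d)) (squareFreeDivisors-unique n)

  split-unique : Unique (coprimes ++ map (p *_) coprimes)
  split-unique = Unique.++⁺ coprimes-unique (Unique.map⁺ (*-cancelˡ-≡ _ _ p) coprimes-unique)
    -- The halves are disjoint: p divides every entry of the second and none of the first.
    λ { (d∈ , d∈′) → case ∈-map⁻ (p *_) d∈′ of λ
      { (e , _ , refl) → proj₂ (∈-coprimes⁻ d∈) (m∣m*n e) } }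

  to : ∀ {d} → d ∈ squareFreeDivisors n → d ∈ coprimes ++ map (p *_) coprimes
  to {d} d∈ with p ∣? d | ∈-squareFreeDivisors⁻ {n} d∈
  ... | no p∤d | sf , d∣n = ∈-++⁺ˡ (∈-coprimes⁺ sf d∣n p∤d)
  -- Here d = e * p, and square-freeness of d keeps p from dividing e, so e lies in `coprimes`.
  ... | yes (divides e refl) | sf , d∣n = ∈-++⁺ʳ coprimes
    (subst (_∈ map (p *_) coprimes) (*-comm p e) (∈-map⁺ (p *_)
      (∈-coprimes⁺ (squareFree-∣ (m∣m*n p) sf) (∣-trans (m∣m*n p) d∣n)
        (squareFree-*⇒∤ pr (subst SquareFree (*-comm e p) sf)))))

  from : ∀ {d} → d ∈ coprimes ++ map (p *_) coprimes → d ∈ squareFreeDivisors n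
  from d∈ with ∈-++⁻ coprimes d∈
  ... | inj₁ d∈ˡ = let (sf , d∣n) , _ = ∈-coprimes⁻ d∈ˡ in ∈-squareFreeDivisors⁺ sf d∣n
  ... | inj₂ d∈ʳ with e , e∈ , refl ← ∈-map⁻ (p *_) d∈ʳ =
    let (sf , e∣n) , p∤e = ∈-coprimes⁻ e∈ in
    ∈-squareFreeDivisors⁺ (squareFree-* pr p∤e sf) (prime*∣ pr p∤e p∣n e∣n)

  length≡ : length (squareFreeDivisors n) ≡ length coprimes + length coprimes
  length≡ = trans (unique∧⇔⇒length≡ (squareFreeDivisors-unique n) split-unique (mk⇔ to from))
    (trans (length-++ coprimes) (cong (length coprimes +_) (length-map (p *_) coprimes)))

-- Square-free proper divisors greater than 1

NontrivialSquareFree : ℕ → Set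
NontrivialSquareFree n = 1 < n × SquareFree n

-- Opaque, so that a case split on 1 <? n does not reach inside it.
abstract
  nontrivialSquareFree? : Decidable NontrivialSquareFree
  nontrivialSquareFree? n = 1 <? n ×-dec squareFree? n

nontrivialSquareFreeProperDivisors : ∀ n → List (Fin n)
nontrivialSquareFreeProperDivisors n = filter (λ d → nontrivialSquareFree? (toℕ d)) (properDivisors n)

module _ {n} (1<n : 1 < n) where
  private
    instance _ = >-nonZero (<-trans z<s 1<n)

    -- Taken in ℕ rather than `Fin n`, for comparison with `squareFreeDivisors n`, which may contain
    -- n itself.
    ds : List ℕ
    ds = map toℕ (nontrivialSquareFreeProperDivisors n)

    ds-unique : Unique ds
    ds-unique = Unique.map⁺ toℕ-injective
      (Unique.filter⁺ _ (Unique.filter⁺ (λ d → isProperDivisor? n (toℕ d)) (Unique.allFin⁺ n)))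

    ∈-ds⁺ : ∀ {d} → 1 < d → d < n → d ∣ n → SquareFree d → d ∈ ds
    ∈-ds⁺ {d} 1<d d<n d∣n sf = subst (_∈ ds) i≡d (∈-map⁺ toℕ
      (∈-filter⁺ (λ d → nontrivialSquareFree? (toℕ d))
        (∈-filter⁺ (λ d → isProperDivisor? n (toℕ d)) (∈-allFin i)
          (subst (IsProperDivisor n) (sym i≡d) (<⇒≤ 1<d , d<n , d∣n)))
        (subst NontrivialSquareFree (sym i≡d) (1<d , sf))))
      where
      i   = fromℕ< d<n
      i≡d = toℕ-fromℕ< d<n

    ∈-ds⁻ : ∀ {d} → d ∈ ds → IsProperDivisor n d × NontrivialSquareFree d
    ∈-ds⁻ d∈ with i , i∈ , refl ← ∈-map⁻ toℕ d∈
      with i∈′ , nsf ← ∈-filter⁻ (λ d → nontrivialSquareFree? (toℕ d)) {xs = properDivisors n} i∈ =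
      proj₂ (∈-filter⁻ (λ d → isProperDivisor? n (toℕ d)) {xs = allFin n} i∈′) , nsf

    1∉ds : All (1 ≢_) ds
    1∉ds = All.tabulate λ d∈ → <⇒≢ (proj₁ (proj₂ (∈-ds⁻ d∈)))

    n∉ds : All (n ≢_) ds
    n∉ds = All.tabulate λ d∈ → ≢-sym (<⇒≢ (proj₁ (proj₂ (proj₁ (∈-ds⁻ d∈)))))

    1∈ : 1 ∈ squareFreeDivisors n
    1∈ = ∈-squareFreeDivisors⁺ squareFree-1 (1∣ n)

    ds⊆ : ∀ {d} → d ∈ ds → d ∈ squareFreeDivisors n
    ds⊆ d∈ = let (_ , _ , d∣n) , (_ , sf) = ∈-ds⁻ d∈ in ∈-squareFreeDivisors⁺ sf d∣n

    -- A divisor of n other than 1 and n is proper and exceeds 1. This pins down by which entries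
    -- the two lists differ.
    cases : ∀ {d} → d ∈ squareFreeDivisors n → d ≡ 1 ⊎ (d ≡ n × SquareFree n) ⊎ d ∈ ds
    cases {d} d∈ with sf , d∣n ← ∈-squareFreeDivisors⁻ {n} d∈ with d ≟ 1 | d ≟ n
    ... | yes d≡1 | _        = inj₁ d≡1
    ... | no _    | yes refl = inj₂ (inj₁ (refl , sf))
    ... | no d≢1  | no d≢n   = inj₂ (inj₂ (∈-ds⁺
      (≤∧≢⇒< (>-nonZero⁻¹ d {{d≢0}}) (≢-sym d≢1)) (≤∧≢⇒< (∣⇒≤ d∣n) d≢n) d∣n sf))
      where d≢0 = ≢-nonZero λ { refl → ≢-nonZero⁻¹ n (0∣⇒≡0 d∣n) }

  -- The number of square-free divisors is even. Removing 1, and also n when n is square-free,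
  -- leaves an even count if n is square-free and an odd one if not.
  parity-nontrivialSquareFreeProperDivisors :
    parity (length (nontrivialSquareFreeProperDivisors n)) ≡ indicator (nontrivialSquareFree? n) ⁻¹
  parity-nontrivialSquareFreeProperDivisors with nontrivialSquareFree? n
  -- The two extra entries 1 and n disappear by computation, as `parity` recurses in steps of two.
  ... | yes (_ , sf) = trans (cong parity (sym (trans length≡ (cong (2 +_) (length-map toℕ (nontrivialSquareFreeProperDivisors n))))))
                         (parity-squareFreeDivisors 1<n)
    where
    length≡ : length (squareFreeDivisors n) ≡ 2 + length ds
    length≡ = unique∧⇔⇒length≡ (squareFreeDivisors-unique n)
      ((<⇒≢ 1<n ∷ 1∉ds) ∷ n∉ds ∷ ds-unique)
      (mk⇔ (λ d∈ → case cases d∈ of λ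
              { (inj₁ d≡1) → here d≡1
              ; (inj₂ (inj₁ (d≡n , _))) → there (here d≡n)
              ; (inj₂ (inj₂ d∈ds)) → there (there d∈ds) })
           λ { (here refl) → 1∈
             ; (there (here refl)) → ∈-squareFreeDivisors⁺ sf ∣-refl
             ; (there (there d∈ds)) → ds⊆ d∈ds })
  -- Only the entry 1 is extra here, which costs one flip of the parity.
  ... | no ¬nsf = ℙ.⁻¹-injective (trans (sym (parity-suc (length (nontrivialSquareFreeProperDivisors n))))
      (trans (cong parity (sym (trans length≡ (cong suc (length-map toℕ (nontrivialSquareFreeProperDivisors n))))))
        (parity-squareFreeDivisors 1<n)))
    where
    length≡ : length (squareFreeDivisors n) ≡ 1 + length ds
    length≡ = unique∧⇔⇒length≡ (squareFreeDivisors-unique n) (1∉ds ∷ ds-unique)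
      (mk⇔ (λ d∈ → case cases d∈ of λ
              { (inj₁ d≡1) → here d≡1
              ; (inj₂ (inj₁ (_ , sf))) → contradiction (1<n , sf) ¬nsf
              ; (inj₂ (inj₂ d∈ds)) → there d∈ds })
           λ { (here refl) → 1∈
             ; (there d∈ds) → ds⊆ d∈ds })

-- Values of heaps

-- By induction the sum of proper divisors has the parity of the number of those that are
-- square-free and exceed 1. That parity is opposite to the indicator of n, so the single move flips
-- the value as required.
heapStep-alternating : ∀ n → (∀ {d} → d < n → Alternating (indicator (nontrivialSquareFree? d)) (heap d)) →
                       Alternating (indicator (nontrivialSquareFree? n)) (heapStep n (λ {d} _ → heap d))
heapStep-alternating n IH with 1 <? n
... | no 1≮n  = subst (λ r → Alternating r 𝟘) (sym (indicator-no (nontrivialSquareFree? n) λ (1<n , _) → 1≮n 1<n))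
  𝟘-alternating
-- `Fin.zero` is the only option of the heap.
... | yes 1<n = alternating (λ _ → Fin.zero) λ _ → subst (λ r → Alternating r (⨁ (map (λ d → heap (toℕ d)) (properDivisors n))))
  (parity-nontrivialSquareFreeProperDivisors 1<n)
  (⨁-alternating (λ d → nontrivialSquareFree? (toℕ d)) (λ d → heap (toℕ d)) (λ d → IH (toℕ<n d)) (properDivisors n))

heap-alternating : ∀ n → Alternating (indicator (nontrivialSquareFree? n)) (heap n)
heap-alternating = <-rec _ λ n IH →
  subst (Alternating _) (sym (heap-unfold n)) (heapStep-alternating n IH)

mainTheorem14 : (n : ℕ) → .{{_ : NonZero n}} →
    (SG (heap n) ≡ 0 ⊎ SG (heap n) ≡ 1) × (SG (heap n) ≡ 1 ⇔ (1 < n × SquareFree n))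
mainTheorem14 n with nontrivialSquareFree? n | SG-alternating (heap-alternating n)
... | yes nsf | SG≡1 = inj₂ SG≡1 , mk⇔ (λ _ → nsf) (λ _ → SG≡1)
... | no ¬nsf | SG≡0 = inj₁ SG≡0 ,
  mk⇔ (λ SG≡1 → case trans (sym SG≡0) SG≡1 of λ ()) (λ nsf → contradiction nsf ¬nsf)
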